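{- Let $n$ and $r$ be positive integers with $n \geq 2r$, and let $G$ be an elongated claw with $n$ leaves and a short limb (that is, at least one short limb). Then $G$ is $r$-EKR.
   Context: Graphs are finite, simple and undirected. An independent set of a graph is a set of pairwise non-adjacent vertices. For a graph $G$ and an integer $r \geq 1$, $\mathcal{I}^{(r)}(G)$ denotes the family of independent sets of $G$ of cardinality $r$. For a vertex $v$ of $G$, $\mathcal{I}^{(r)}_v(G) = \{A \in \mathcal{I}^{(r)}(G) : v \in A\}$; this family is called the $r$-star centred at $v$. A family of sets is pairwise intersecting if any two of its members have nonempty intersection. $G$ is $r$-EKR if no pairwise intersecting family $\mathcal{A} \subseteq \mathcal{I}^{(r)}(G)$ is larger than the largest $r$-star of $G$. An elongated claw is a tree with one vertex designated as its root, such that every vertex other than the root has degree 1 or 2 (the root may have any degree, possibly 1 or 2). A vertex of degree 1 is called a leaf, and a path from the root to a leaf is called a limb. A limb is short if it contains only one edge. -}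

module Defs where

open import Data.Fin.Base using (Fin)
open import Data.Fin.Properties using (all?)
open import Data.Fin.Subset using (Subset; inside; outside; _∈_; _∩_; ∣_∣; Nonempty)
open import Data.Fin.Subset.Properties using (_∈?_)
open import Data.List.Base using (List; []; _∷_; [_]; _++_; map; filter; length; allFin)
open import Data.List.Extrema.Nat using (max)
import Data.List.Membership.Propositional as List
open import Data.List.Relation.Binary.Subset.Propositional using (_⊆_)
open import Data.List.Relation.Unary.Unique.Propositional using (Unique)
open import Data.Nat.Base using (ℕ; zero; suc; _≤_)
open import Data.Nat.Properties using (_≟_)
open import Data.Product.Base using (_×_; ∃-syntax)
open import Data.Sum.Base using (_⊎_)
import Data.Vec.Base as Vec
open import Level using (0ℓ)
open import Relation.Binary.Core using (Rel)
open import Relation.Binary.Construct.Closure.ReflexiveTransitive using (Star; ε; _◅_)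
open import Relation.Binary.Definitions using (Decidable; Symmetric)
open import Relation.Binary.PropositionalEquality.Core using (_≡_; _≢_)
open import Relation.Nullary.Decidable.Core using (Dec; _×-dec_; _→-dec_; ¬?)
open import Relation.Nullary.Negation.Core using (¬_)

record Graph (m : ℕ) : Set₁ where
  field
    Adj    : Rel (Fin m) 0ℓ
    adj?   : Decidable Adj
    symm   : Symmetric Adj
    irrefl : ∀ {v} → ¬ Adj v v

module _ {m : ℕ} (G : Graph m) where
  open Graph G

  degree : Fin m → ℕ
  degree v = length (filter (adj? v) (allFin m))

  Walk : Rel (Fin m) 0ℓ
  Walk = Star Adj

  vertices : ∀ {u v} → Walk u v → List (Fin m)
  vertices {u} ε       = [ u ]
  vertices {u} (_ ◅ p) = u ∷ vertices p

  edgeCount : ∀ {u v} → Walk u v → ℕ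
  edgeCount ε       = 0
  edgeCount (_ ◅ p) = suc (edgeCount p)

  IsPath : ∀ {u v} → Walk u v → Set
  IsPath p = Unique (vertices p)

  Connected : Set
  Connected = ∀ u v → Walk u v

  -- A cycle is a path with at least two edges whose endpoints are adjacent.
  Acyclic : Set
  Acyclic = ∀ {u v} (p : Walk u v) → IsPath p → 2 ≤ edgeCount p → ¬ Adj v u

  record IsTree : Set where
    field
      connected : Connected
      acyclic   : Acyclic

  record IsElongatedClaw (root : Fin m) : Set where
    field
      isTree     : IsTree
      degree-1-2 : ∀ v → v ≢ root → degree v ≡ 1 ⊎ degree v ≡ 2

  -- A root of degree 1 counts as a leaf.
  IsLeaf : Fin m → Set
  IsLeaf v = degree v ≡ 1

  leaves : List (Fin m)
  leaves = filter (λ v → degree v ≟ 1) (allFin m)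

  record Limb (root : Fin m) : Set where
    field
      end    : Fin m
      isLeaf : IsLeaf end
      walk   : Walk root end
      isPath : IsPath walk

  Short : ∀ {root} → Limb root → Set
  Short l = edgeCount (Limb.walk l) ≡ 1

  HasShortLimb : Fin m → Set
  HasShortLimb root = ∃[ l ] Short {root} l

  Independent : Subset m → Set
  Independent A = ∀ u v → u ∈ A → v ∈ A → ¬ Adj u v

  independent? : ∀ A → Dec (Independent A)
  independent? A =
    all? λ u → all? λ v → (u ∈? A) →-dec ((v ∈? A) →-dec ¬? (adj? u v))

-- Each subset of Fin m is listed exactly once.
subsets : ∀ m → List (Subset m)
subsets zero    = [ Vec.[] ]
subsets (suc m) =
  map (inside Vec.∷_) (subsets m) ++ map (outside Vec.∷_) (subsets m)

module _ {m : ℕ} (G : Graph m) (r : ℕ) where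

  𝓘 : List (Subset m)
  𝓘 = filter (λ A → independent? G A ×-dec (∣ A ∣ ≟ r)) (subsets m)

  star : Fin m → List (Subset m)
  star v = filter (v ∈?_) 𝓘

  largestStarSize : ℕ
  largestStarSize = max 0 (map (λ v → length (star v)) (allFin m))

PairwiseIntersecting : ∀ {m} → List (Subset m) → Set
PairwiseIntersecting 𝒜 = ∀ {A B} → A List.∈ 𝒜 → B List.∈ 𝒜 → Nonempty (A ∩ B)

-- A family of sets is a duplicate-free list, so that its size is its length.
EKR : ℕ → ∀ {m} → Graph m → Set
EKR r {m} G =
  (𝒜 : List (Subset m)) → Unique 𝒜 → 𝒜 ⊆ 𝓘 G r → PairwiseIntersecting 𝒜 →
  length 𝒜 ≤ largestStarSize G r

{-# OPTIONS --safe #-}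
-- Let c be the root and v the leaf of a short limb; every family is compared with the star at v.
-- Choose a vertex a at maximal distance from c, with neighbour b, and let d be the other neighbour
-- of b.  Replace a by b in the members A ∋ a with d ∉ A, unless this yields a set already present
-- (this is contraction of the edge ab).  The sets without a are then an intersecting family on
-- G − a, and the sets A − a, for A ∋ a, are an intersecting family of (r − 1)-sets on G − a − b.
-- By induction each is at most a star at v, and the star at v in G splits in the same way.
-- G − a has as many leaves as G, and G − a − b at most one fewer, so n ≥ 2r persists.  When all
-- vertices are within distance 1 of c, an independent set of size at least 2 avoids c, and the
-- bound is the Erdős–Ko–Rado theorem on the leaves.
module Submission where

open import Data.Fin.Base using (Fin; zero; suc)
open import Data.Fin.Properties using (any?) renaming (_≟_ to _≟ᶠ_)
open import Data.Fin.Subset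
  using (Subset; inside; outside; _∈_; _∉_; _⊆_; _∩_; _∪_; ∁; ⊤; ⊥; ⁅_⁆; ∣_∣; Nonempty)
open import Data.Fin.Subset.Properties
  using (_∈?_; ⊆-antisym; p⊆q⇒∣p∣≤∣q∣; x∈p∩q⁺; x∈p∩q⁻; x∈p∪q⁺; nonempty?; ∉⊥; ∣⊥∣≡0; ∈⊤;
         ∣⁅x⁆∣≡1; x∈⁅x⁆; x∈⁅y⁆⇒x≡y; x∈p⇒x∉∁p; x∉p⇒x∈∁p; Empty-unique;
         drop-∷-⊆)
open import Data.List.Base using (List; []; _∷_; [_]; _++_; map; filter; length; allFin)
open import Data.List.Extrema.Nat using (argmax; argmax-all; f[xs]≤f[argmax]; v≤max⁺)
open import Data.List.Membership.Propositional using (find; lose) renaming (_∈_ to _∈ˡ_; _∉_ to _∉ˡ_)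
open import Data.List.Membership.Propositional.Properties
  using (∈-++⁻; ∈-++⁺ˡ; ∈-++⁺ʳ; ∈-map⁺; ∈-map⁻; ∈-filter⁺; ∈-filter⁻; ∈-∃++; ∈-allFin)
import Data.List.Membership.DecPropositional as DecMembership
open import Data.List.Properties using (length-++; length-map)
open import Data.List.Relation.Unary.All as All using (All; []; _∷_)
open import Data.List.Relation.Unary.AllPairs using ([]; _∷_)
open import Data.List.Relation.Unary.Any as Any using (Any; here; there)
open import Data.List.Relation.Unary.Unique.Propositional using (Unique)
import Data.List.Relation.Unary.Unique.Propositional.Properties as Unique
open import Data.Nat.Base using (ℕ; zero; suc; _+_; _*_; _≤_; _<_; _≥_; z≤n; s≤s; s≤s⁻¹)
open import Data.Nat.Induction using (<-rec)
open import Data.Nat.Properties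
open import Data.Product.Base using (_×_; _,_; proj₁; proj₂; ∃-syntax)
open import Data.Sum.Base using (_⊎_; inj₁; inj₂; [_,_]′)
open import Data.Unit.Base using (tt) renaming (⊤ to Unit)
open import Data.Bool.Properties using () renaming (_≟_ to _≟ᵇ_)
open import Data.Vec.Base using (_[_]≔_; here; there)
import Data.Vec.Base as Vec
open import Data.Vec.Properties using ([]≔-updates; []≔-minimal; ≡-dec)
open import Function.Base using (_∘_)
open import Relation.Binary.Construct.Closure.ReflexiveTransitive using (Star; ε; _◅_; _◅◅_; reverse)
open import Relation.Binary.PropositionalEquality
  using (_≡_; _≢_; refl; sym; trans; cong; subst)
open import Relation.Nullary using (¬_; Dec; yes; no; contradiction; ¬?; _×-dec_)
open import Relation.Unary using (Pred; Decidable)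
open import Level using (0ℓ)
open import Defs

-- Counting in duplicate-free lists

length-filter-split : ∀ {a p} {A : Set a} {P : Pred A p} (P? : Decidable P) xs →
  length xs ≡ length (filter (¬? ∘ P?) xs) + length (filter P? xs)
length-filter-split P? []       = refl
length-filter-split P? (x ∷ xs) with P? x
... | yes _ = trans (cong suc (length-filter-split P? xs)) (sym (+-suc _ _))
... | no  _ = cong suc (length-filter-split P? xs)

-- Injectivity is asked only on members of the list: inserting, deleting and shifting points are
-- injective only on sets known to contain or to miss those points.
Unique-map-on : ∀ {a b} {A : Set a} {B : Set b} {f : A → B} {xs} →
  (∀ {x y} → x ∈ˡ xs → y ∈ˡ xs → f x ≡ f y → x ≡ y) → Unique xs → Unique (map f xs)
Unique-map-on {xs = []}     inj _        = []
Unique-map-on {f = f} {xs = x ∷ xs} inj (x# ∷ xs!) =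
  All.tabulate (λ y∈ fx≡y → let z , z∈ , y≡fz = ∈-map⁻ f y∈ in
    All.lookup x# z∈ (inj (here refl) (there z∈) (trans fx≡y y≡fz)))
  ∷ Unique-map-on (λ p q → inj (there p) (there q)) xs!

Unique-⊆⇒length≤ : ∀ {a} {A : Set a} {xs ys : List A} →
  Unique xs → (∀ {x} → x ∈ˡ xs → x ∈ˡ ys) → length xs ≤ length ys
Unique-⊆⇒length≤ {xs = []} _ _ = z≤n
Unique-⊆⇒length≤ {xs = x ∷ xs} (x# ∷ xs!) xs⊆ with ∈-∃++ (xs⊆ (here refl))
... | as , bs , refl = begin
  suc (length xs)          ≤⟨ s≤s (Unique-⊆⇒length≤ xs! sub) ⟩
  suc (length (as ++ bs))  ≡⟨ cong suc (length-++ as) ⟩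
  suc (length as + length bs) ≡⟨ sym (+-suc _ _) ⟩
  length as + suc (length bs) ≡⟨ sym (length-++ as) ⟩
  length (as ++ [ x ] ++ bs) ∎
  where
  open ≤-Reasoning
  sub : ∀ {y} → y ∈ˡ xs → y ∈ˡ as ++ bs
  sub y∈ with ∈-++⁻ as (xs⊆ (there y∈))
  ... | inj₁ y∈as            = ∈-++⁺ˡ y∈as
  ... | inj₂ (here y≡x)      = contradiction (sym y≡x) (All.lookup x# y∈)
  ... | inj₂ (there y∈bs)    = ∈-++⁺ʳ as y∈bs

maximiser : ∀ {m} (f : Fin m → ℕ) {A : Subset m} → Nonempty A →
  ∃[ a ] a ∈ A × (∀ {x} → x ∈ A → f x ≤ f a)
maximiser {m} f {A} (z , z∈A) =
  argmax f z xs ,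
  argmax-all f {xs = xs} z∈A (All.tabulate (proj₂ ∘ ∈-filter⁻ (_∈? A) {xs = allFin m})) ,
  λ x∈A → All.lookup (f[xs]≤f[argmax] z xs) (∈-filter⁺ (_∈? A) (∈-allFin _) x∈A)
  where xs = filter (_∈? A) (allFin m)

-- Inserting and deleting one point of a subset

infixl 6 _⊕_ _⊖_

_⊕_ _⊖_ : ∀ {m} → Subset m → Fin m → Subset m
A ⊕ x = A [ x ]≔ inside
A ⊖ x = A [ x ]≔ outside

module _ {m : ℕ} where

  x∈A⊕x : ∀ (A : Subset m) x → x ∈ A ⊕ x
  x∈A⊕x = []≔-updates

  ∈-⊕⁺ : ∀ {A : Subset m} {x y} → y ∈ A → y ∈ A ⊕ x
  ∈-⊕⁺ {A} {x} {y} y∈A with y ≟ᶠ x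
  ... | yes refl = x∈A⊕x A x
  ... | no  y≢x  = []≔-minimal A y x y≢x y∈A

  ∈-⊖⁺ : ∀ {A : Subset m} {x y} → y ∈ A → y ≢ x → y ∈ A ⊖ x
  ∈-⊖⁺ {A} {x} {y} y∈A y≢x = []≔-minimal A y x y≢x y∈A

∈-⊕⁻ : ∀ {m} {A : Subset m} {x y} → y ∈ A ⊕ x → y ≡ x ⊎ y ∈ A
∈-⊕⁻ {A = _ Vec.∷ _} {zero}  here      = inj₁ refl
∈-⊕⁻ {A = _ Vec.∷ _} {zero}  (there p) = inj₂ (there p)
∈-⊕⁻ {A = _ Vec.∷ _} {suc x} here      = inj₂ here
∈-⊕⁻ {A = _ Vec.∷ _} {suc x} (there p) with ∈-⊕⁻ {x = x} p
... | inj₁ refl = inj₁ refl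
... | inj₂ q    = inj₂ (there q)

x∉A⊖x : ∀ {m} (A : Subset m) x → x ∉ A ⊖ x
x∉A⊖x (_ Vec.∷ A) (suc x) (there p) = x∉A⊖x A x p

∈-⊖⁻ : ∀ {m} {A : Subset m} {x y} → y ∈ A ⊖ x → y ∈ A
∈-⊖⁻ {A = _ Vec.∷ _} {zero}  (there p) = there p
∈-⊖⁻ {A = _ Vec.∷ _} {suc x} here      = here
∈-⊖⁻ {A = _ Vec.∷ _} {suc x} (there p) = there (∈-⊖⁻ {x = x} p)

∈-⊖⇒≢ : ∀ {m} {A : Subset m} {x y} → y ∈ A ⊖ x → y ≢ x
∈-⊖⇒≢ {A = A} y∈ refl = x∉A⊖x A _ y∈

∣A⊕x∣ : ∀ {m} {A : Subset m} {x} → x ∉ A → ∣ A ⊕ x ∣ ≡ suc ∣ A ∣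
∣A⊕x∣ {A = inside  Vec.∷ A} {zero}  x∉A = contradiction here x∉A
∣A⊕x∣ {A = outside Vec.∷ A} {zero}  x∉A = refl
∣A⊕x∣ {A = inside  Vec.∷ A} {suc x} x∉A = cong suc (∣A⊕x∣ (x∉A ∘ there))
∣A⊕x∣ {A = outside Vec.∷ A} {suc x} x∉A = ∣A⊕x∣ (x∉A ∘ there)

∣A⊖x∣ : ∀ {m} {A : Subset m} {x} → x ∈ A → suc ∣ A ⊖ x ∣ ≡ ∣ A ∣
∣A⊖x∣ {A = inside  Vec.∷ A} {zero}  here      = refl
∣A⊖x∣ {A = inside  Vec.∷ A} {suc x} (there p) = cong suc (∣A⊖x∣ p)
∣A⊖x∣ {A = outside Vec.∷ A} {suc x} (there p) = ∣A⊖x∣ p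

∣A∣≤1+∣A⊖x∣ : ∀ {m} {A : Subset m} {x} → ∣ A ∣ ≤ suc ∣ A ⊖ x ∣
∣A∣≤1+∣A⊖x∣ {A = A} {x} with x ∈? A
... | yes x∈A = ≤-reflexive (sym (∣A⊖x∣ x∈A))
... | no  x∉A = m≤n⇒m≤1+n (p⊆q⇒∣p∣≤∣q∣ {p = A} λ y∈ → ∈-⊖⁺ y∈ λ { refl → x∉A y∈ })

∣A∪B∣≤∣A∣+∣B∣ : ∀ {m} (A B : Subset m) → ∣ A ∪ B ∣ ≤ ∣ A ∣ + ∣ B ∣
∣A∪B∣≤∣A∣+∣B∣ Vec.[] Vec.[] = z≤n
∣A∪B∣≤∣A∣+∣B∣ (outside Vec.∷ A) (outside Vec.∷ B) = ∣A∪B∣≤∣A∣+∣B∣ A B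
∣A∪B∣≤∣A∣+∣B∣ (outside Vec.∷ A) (inside  Vec.∷ B) rewrite +-suc ∣ A ∣ ∣ B ∣ = s≤s (∣A∪B∣≤∣A∣+∣B∣ A B)
∣A∪B∣≤∣A∣+∣B∣ (inside  Vec.∷ A) (outside Vec.∷ B) = s≤s (∣A∪B∣≤∣A∣+∣B∣ A B)
∣A∪B∣≤∣A∣+∣B∣ (inside  Vec.∷ A) (inside  Vec.∷ B) rewrite +-suc ∣ A ∣ ∣ B ∣ =
  s≤s (m≤n⇒m≤1+n (∣A∪B∣≤∣A∣+∣B∣ A B))

∣S∩∁A∣+∣A∣ : ∀ {m} (S A : Subset m) → A ⊆ S → ∣ S ∩ ∁ A ∣ + ∣ A ∣ ≡ ∣ S ∣
∣S∩∁A∣+∣A∣ Vec.[]              Vec.[]              _   = refl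
∣S∩∁A∣+∣A∣ (inside  Vec.∷ S) (inside  Vec.∷ A) A⊆S =
  trans (+-suc _ _) (cong suc (∣S∩∁A∣+∣A∣ S A (drop-∷-⊆ A⊆S)))
∣S∩∁A∣+∣A∣ (inside  Vec.∷ S) (outside Vec.∷ A) A⊆S = cong suc (∣S∩∁A∣+∣A∣ S A (drop-∷-⊆ A⊆S))
∣S∩∁A∣+∣A∣ (outside Vec.∷ S) (outside Vec.∷ A) A⊆S = ∣S∩∁A∣+∣A∣ S A (drop-∷-⊆ A⊆S)
∣S∩∁A∣+∣A∣ (outside Vec.∷ S) (inside  Vec.∷ A) A⊆S = contradiction (A⊆S here) λ ()

-- Families of sets and their splitting at a point

Family : ℕ → Set
Family m = List (Subset m)

⊖-cancel : ∀ {m} {A B : Subset m} {x} → x ∈ A → x ∈ B → A ⊖ x ⊆ B ⊖ x → A ⊆ B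
⊖-cancel {x = x} x∈A x∈B sub {y} y∈A with y ≟ᶠ x
... | yes refl = x∈B
... | no  y≢x  = ∈-⊖⁻ (sub (∈-⊖⁺ y∈A y≢x))

⊖-injective-on : ∀ {m} {A B : Subset m} {x} → x ∈ A → x ∈ B → A ⊖ x ≡ B ⊖ x → A ≡ B
⊖-injective-on {A = A} {B} {x} x∈A x∈B eq = ⊆-antisym
  (⊖-cancel x∈A x∈B λ {y} → subst (y ∈_) eq)
  (⊖-cancel x∈B x∈A λ {y} → subst (y ∈_) (sym eq))

⊕-injective-on : ∀ {m} {A B : Subset m} {x} → x ∉ A → x ∉ B → A ⊕ x ≡ B ⊕ x → A ≡ B
⊕-injective-on {A = A} {B} {x} x∉A x∉B eq = ⊆-antisym (sub x∉A eq) (sub x∉B (sym eq))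
  where
  sub : ∀ {A B} → x ∉ A → A ⊕ x ≡ B ⊕ x → A ⊆ B
  sub x∉A eq y∈A with ∈-⊕⁻ (subst (_ ∈_) eq (∈-⊕⁺ {x = x} y∈A))
  ... | inj₁ refl = contradiction y∈A x∉A
  ... | inj₂ y∈B  = y∈B

meet : ∀ {m} {𝓕 : Family m} → PairwiseIntersecting 𝓕 →
  ∀ {A B} → A ∈ˡ 𝓕 → B ∈ˡ 𝓕 → ∃[ y ] y ∈ A × y ∈ B
meet int {A} {B} A∈ B∈ = let y , y∈ = int A∈ B∈ in y , x∈p∩q⁻ A B y∈

infix 4 _∈ᶠ?_

_∈ᶠ?_ : ∀ {m} (A : Subset m) (𝓕 : Family m) → Dec (A ∈ˡ 𝓕)
_∈ᶠ?_ = DecMembership._∈?_ (≡-dec _≟ᵇ_)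

module Split {m} (x : Fin m) (𝓕 : Family m) where

  without link : Family m
  without = filter (¬? ∘ (x ∈?_)) 𝓕
  link    = map (_⊖ x) (filter (x ∈?_) 𝓕)

  length-split : length 𝓕 ≡ length without + length link
  length-split = trans (length-filter-split (x ∈?_) 𝓕)
    (cong (length without +_) (sym (length-map (_⊖ x) (filter (x ∈?_) 𝓕))))

  without⁻ : ∀ {A} → A ∈ˡ without → A ∈ˡ 𝓕 × x ∉ A
  without⁻ = ∈-filter⁻ (¬? ∘ (x ∈?_))

  link⁻ : ∀ {B} → B ∈ˡ link → ∃[ A ] A ∈ˡ 𝓕 × x ∈ A × B ≡ A ⊖ x
  link⁻ B∈ = let A , A∈ , eq = ∈-map⁻ (_⊖ x) B∈ ; A∈𝓕 , x∈A = ∈-filter⁻ (x ∈?_) A∈ in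
    A , A∈𝓕 , x∈A , eq

  without-unique : Unique 𝓕 → Unique without
  without-unique = Unique.filter⁺ (¬? ∘ (x ∈?_))

  link-unique : Unique 𝓕 → Unique link
  link-unique 𝓕! = Unique-map-on
    (λ A∈ B∈ → ⊖-injective-on (proj₂ (∈-filter⁻ (x ∈?_) {xs = 𝓕} A∈)) (proj₂ (∈-filter⁻ (x ∈?_) {xs = 𝓕} B∈)))
    (Unique.filter⁺ (x ∈?_) 𝓕!)

  without-intersecting : PairwiseIntersecting 𝓕 → PairwiseIntersecting without
  without-intersecting int A∈ B∈ = int (proj₁ (without⁻ A∈)) (proj₁ (without⁻ B∈))

  -- Deleting `x` spoils an intersection only when `x` was the sole common point. The compressions
  -- below serve to exclude this.
  link-intersecting :
    (∀ {A B} → A ∈ˡ 𝓕 → B ∈ˡ 𝓕 → x ∈ A → x ∈ B → ∃[ y ] y ≢ x × y ∈ A × y ∈ B) →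
    PairwiseIntersecting link
  link-intersecting meet′ A′∈ B′∈ with link⁻ A′∈ | link⁻ B′∈
  ... | A , A∈ , x∈A , refl | B , B∈ , x∈B , refl =
    let y , y≢x , y∈A , y∈B = meet′ A∈ B∈ x∈A x∈B in
    y , x∈p∩q⁺ (∈-⊖⁺ y∈A y≢x , ∈-⊖⁺ y∈B y≢x)

-- Compression of a family

shift : ∀ {m} → Fin m → Fin m → Subset m → Subset m
shift x i A = A ⊖ x ⊕ i

module _ {m} {x i : Fin m} (x≢i : x ≢ i) where

  x∉shift : ∀ {A} → x ∉ shift x i A
  x∉shift {A} x∈ with ∈-⊕⁻ x∈
  ... | inj₁ x≡i = x≢i x≡i
  ... | inj₂ x∈′ = x∉A⊖x A x x∈′

  ∈-shift⁻ : ∀ {A y} → y ∈ shift x i A → y ≡ i ⊎ (y ∈ A × y ≢ x)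
  ∈-shift⁻ {A} y∈ with ∈-⊕⁻ y∈
  ... | inj₁ y≡i = inj₁ y≡i
  ... | inj₂ y∈′ = inj₂ (∈-⊖⁻ y∈′ , ∈-⊖⇒≢ {A = A} y∈′)

  ∈-shift⁺ : ∀ {A y} → y ∈ A → y ≢ x → y ∈ shift x i A
  ∈-shift⁺ y∈A y≢x = ∈-⊕⁺ (∈-⊖⁺ y∈A y≢x)

  ∣shift∣ : ∀ {A} → x ∈ A → i ∉ A → ∣ shift x i A ∣ ≡ ∣ A ∣
  ∣shift∣ x∈A i∉A = trans (∣A⊕x∣ (i∉A ∘ ∈-⊖⁻)) (∣A⊖x∣ x∈A)

-- The predicate `P` lets one construction serve twice. The trivial predicate gives the classical
-- shift of Erdős-Ko-Rado; the predicate `d ∉ A` gives the contraction of an edge of a claw.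
module Compression {m} {x i : Fin m} (x≢i : x ≢ i)
  {P : Pred (Subset m) 0ℓ} (P? : Decidable P) (𝓕 : Family m) where

  Moves : Pred (Subset m) 0ℓ
  Moves A = x ∈ A × i ∉ A × P A × shift x i A ∉ˡ 𝓕

  moves? : Decidable Moves
  moves? A = (x ∈? A) ×-dec ¬? (i ∈? A) ×-dec P? A ×-dec ¬? (shift x i A ∈ᶠ? 𝓕)

  kept moved compress : Family m
  kept     = filter (¬? ∘ moves?) 𝓕
  moved    = map (shift x i) (filter moves? 𝓕)
  compress = kept ++ moved

  moved⁻ : ∀ {B} → B ∈ˡ moved → ∃[ A ] A ∈ˡ 𝓕 × Moves A × B ≡ shift x i A
  moved⁻ B∈ = let A , A∈ , eq = ∈-map⁻ (shift x i) B∈ ; A∈𝓕 , mv = ∈-filter⁻ moves? A∈ in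
    A , A∈𝓕 , mv , eq

  kept⁻ : ∀ {A} → A ∈ˡ kept → A ∈ˡ 𝓕 × ¬ Moves A
  kept⁻ = ∈-filter⁻ (¬? ∘ moves?)

  compress⁻ : ∀ {B} → B ∈ˡ compress →
    (B ∈ˡ 𝓕 × ¬ Moves B) ⊎ (∃[ A ] A ∈ˡ 𝓕 × Moves A × B ≡ shift x i A)
  compress⁻ B∈ with ∈-++⁻ kept B∈
  ... | inj₁ B∈′ = inj₁ (kept⁻ B∈′)
  ... | inj₂ B∈′ = inj₂ (moved⁻ B∈′)

  length-compress : length compress ≡ length 𝓕
  length-compress = trans (length-++ kept)
    (trans (cong (length kept +_) (length-map (shift x i) (filter moves? 𝓕)))
           (sym (length-filter-split moves? 𝓕)))

  -- By `Moves`, a moved set is new to `𝓕`, so it differs from every kept one. The shift is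
  -- injective on the sets that move, since all of them contain `x` and miss `i`.
  compress-unique : Unique 𝓕 → Unique compress
  compress-unique 𝓕! = Unique.++⁺ (Unique.filter⁺ (¬? ∘ moves?) 𝓕!)
    (Unique-map-on inj (Unique.filter⁺ moves? 𝓕!)) disjoint
    where
    inj : ∀ {A B} → A ∈ˡ filter moves? 𝓕 → B ∈ˡ filter moves? 𝓕 → shift x i A ≡ shift x i B → A ≡ B
    inj A∈ B∈ eq with ∈-filter⁻ moves? {xs = 𝓕} A∈ | ∈-filter⁻ moves? {xs = 𝓕} B∈
    ... | _ , x∈A , i∉A , _ | _ , x∈B , i∉B , _ =
      ⊖-injective-on x∈A x∈B (⊕-injective-on (i∉A ∘ ∈-⊖⁻) (i∉B ∘ ∈-⊖⁻) eq)
    disjoint : ∀ {A} → ¬ (A ∈ˡ kept × A ∈ˡ moved)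
    disjoint (A∈k , A∈m) with moved⁻ A∈m
    ... | _ , _ , (_ , _ , _ , s∉) , refl = s∉ (proj₁ (kept⁻ A∈k))

-- Bounds by a star

-- The bound is an explicit list of distinct sets through `v` instead of a number, so that bounds
-- for the parts of a family can be glued without computing the size of any star.
record StarBound {m} (v : Fin m) (Adm : Pred (Subset m) 0ℓ) (r : ℕ) (𝓕 : Family m) : Set where
  constructor starBound
  field
    stars    : Family m
    unique   : Unique stars
    sound    : ∀ {A} → A ∈ˡ stars → Adm A × ∣ A ∣ ≡ r × v ∈ A
    bounding : length 𝓕 ≤ length stars

empty-family : ∀ {m} {v : Fin m} {Adm r} {𝓕 : Family m} → (∀ {A} → ¬ A ∈ˡ 𝓕) → StarBound v Adm r 𝓕
empty-family {𝓕 = []}    none = starBound [] [] (λ ()) z≤n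
empty-family {𝓕 = A ∷ 𝓕} none = contradiction (here refl) none

no-empty-sets : ∀ {m} {𝓕 : Family m} → PairwiseIntersecting 𝓕 → (∀ {A} → A ∈ˡ 𝓕 → ∣ A ∣ ≡ 0) →
  ∀ {A} → ¬ A ∈ˡ 𝓕
no-empty-sets int size {A} A∈ with meet int A∈ A∈
... | y , y∈A , _ with trans (∣A⊖x∣ y∈A) (size A∈)
... | ()

-- The star at `v` splits at `x` just as the family does: the sets of the first list miss `x`, those
-- of the second receive it, so the two lists are disjoint.
glue : ∀ {m} {v x : Fin m} {Adm Adm₀ Adm₁ : Pred (Subset m) 0ℓ} {r} {𝓕 : Family m} →
  (∀ {A} → Adm₀ A → Adm A × x ∉ A) →
  (∀ {A} → Adm₁ A → Adm (A ⊕ x) × x ∉ A) →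
  StarBound v Adm₀ (suc r) (Split.without x 𝓕) →
  StarBound v Adm₁ r (Split.link x 𝓕) →
  StarBound v Adm (suc r) 𝓕
glue {v = v} {x} {Adm} {r = r} {𝓕} adm₀ adm₁ (starBound T₀ T₀! s₀ b₀) (starBound T₁ T₁! s₁ b₁) =
  starBound (T₀ ++ map (_⊕ x) T₁)
    (Unique.++⁺ T₀! (Unique-map-on inj T₁!) disjoint)
    sound
    (begin
      length 𝓕                           ≡⟨ length-split ⟩
      length without + length link       ≤⟨ +-mono-≤ b₀ b₁ ⟩
      length T₀ + length T₁              ≡⟨ cong (length T₀ +_) (sym (length-map (_⊕ x) T₁)) ⟩
      length T₀ + length (map (_⊕ x) T₁) ≡⟨ sym (length-++ T₀) ⟩
      length (T₀ ++ map (_⊕ x) T₁)       ∎)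
  where
  open ≤-Reasoning
  open Split x 𝓕
  x∉₁ : ∀ {A} → A ∈ˡ T₁ → x ∉ A
  x∉₁ A∈ = proj₂ (adm₁ (proj₁ (s₁ A∈)))
  inj : ∀ {A B} → A ∈ˡ T₁ → B ∈ˡ T₁ → A ⊕ x ≡ B ⊕ x → A ≡ B
  inj A∈ B∈ = ⊕-injective-on (x∉₁ A∈) (x∉₁ B∈)
  disjoint : ∀ {A} → ¬ (A ∈ˡ T₀ × A ∈ˡ map (_⊕ x) T₁)
  disjoint (A∈₀ , A∈₁) with ∈-map⁻ (_⊕ x) A∈₁
  ... | B , _ , refl = proj₂ (adm₀ (proj₁ (s₀ A∈₀))) (x∈A⊕x B x)
  sound : ∀ {A} → A ∈ˡ T₀ ++ map (_⊕ x) T₁ → Adm A × ∣ A ∣ ≡ suc r × v ∈ A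
  sound A∈ with ∈-++⁻ T₀ A∈
  ... | inj₁ A∈₀ = let adm , size , v∈ = s₀ A∈₀ in proj₁ (adm₀ adm) , size , v∈
  ... | inj₂ A∈₁ with ∈-map⁻ (_⊕ x) A∈₁
  ...   | B , B∈ , refl = let adm , size , v∈ = s₁ B∈ in
    proj₁ (adm₁ adm) , trans (∣A⊕x∣ (x∉₁ B∈)) (cong suc size) , ∈-⊕⁺ v∈

-- The Erdős–Ko–Rado theorem by shifting

record IntersectingFamily {m} (Adm : Pred (Subset m) 0ℓ) (r : ℕ) (𝓕 : Family m) : Set where
  field
    unique       : Unique 𝓕
    sound        : ∀ {A} → A ∈ˡ 𝓕 → Adm A × ∣ A ∣ ≡ r
    intersecting : PairwiseIntersecting 𝓕

  meets : ∀ {A B} → A ∈ˡ 𝓕 → B ∈ˡ 𝓕 → ∃[ y ] y ∈ A × y ∈ B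
  meets = meet intersecting

open IntersectingFamily

starBound-map : ∀ {m} {v : Fin m} {Adm Adm′ : Pred (Subset m) 0ℓ} {r} {𝓕 : Family m} →
  (∀ {A} → Adm A → Adm′ A) → StarBound v Adm r 𝓕 → StarBound v Adm′ r 𝓕
starBound-map f (starBound T T! snd b) =
  starBound T T! (λ A∈ → let adm , rest = snd A∈ in f adm , rest) b

starBound-≡ : ∀ {m} {v : Fin m} {Adm r} {𝓕 𝓖 : Family m} →
  length 𝓖 ≡ length 𝓕 → StarBound v Adm r 𝓖 → StarBound v Adm r 𝓕
starBound-≡ eq (starBound T T! s b) = starBound T T! s (≤-trans (≤-reflexive (sym eq)) b)

0<∣A∣⇒Nonempty : ∀ {m} {A : Subset m} → 0 < ∣ A ∣ → Nonempty A
0<∣A∣⇒Nonempty {m} {A} 0<∣A∣ with nonempty? A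
... | yes ne = ne
... | no ¬ne = contradiction (trans (cong ∣_∣ (Empty-unique ¬ne)) (∣⊥∣≡0 m)) (>⇒≢ 0<∣A∣)

<∣S∣⇒∃∉ : ∀ {m} {S A : Subset m} → ∣ A ∣ < ∣ S ∣ → ∃[ i ] i ∈ S × i ∉ A
<∣S∣⇒∃∉ {S = S} {A} lt with any? (λ i → (i ∈? S) ×-dec ¬? (i ∈? A))
... | yes found = found
... | no  none  = contradiction (p⊆q⇒∣p∣≤∣q∣ S⊆A) (<⇒≱ lt)
  where
  S⊆A : S ⊆ A
  S⊆A {i} i∈S with i ∈? A
  ... | yes i∈A = i∈A
  ... | no  i∉A = contradiction (i , i∈S , i∉A) none

MeetOutside : ∀ {m} → Fin m → Family m → Set
MeetOutside x 𝓕 = ∀ {A B} → A ∈ˡ 𝓕 → B ∈ˡ 𝓕 → x ∈ A → x ∈ B → ∃[ y ] y ≢ x × y ∈ A × y ∈ B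

-- The second alternative supplies two sets whose only common point is `x`; such a pair triggers the
-- next compression.
meetOutside? : ∀ {m} (x : Fin m) (𝓕 : Family m) →
  MeetOutside x 𝓕 ⊎
  (∃[ A ] ∃[ B ] A ∈ˡ 𝓕 × B ∈ˡ 𝓕 × x ∈ A × x ∈ B × (∀ {y} → y ≢ x → y ∈ A → y ∉ B))
meetOutside? x 𝓕 with Any.any? (λ A → Any.any? (λ B →
    (x ∈? A) ×-dec (x ∈? B) ×-dec ¬? (nonempty? ((A ∩ B) ⊖ x))) 𝓕) 𝓕
... | yes found with find found
...   | A , A∈ , found′ with find found′
...     | B , B∈ , x∈A , x∈B , empty = inj₂ (A , B , A∈ , B∈ , x∈A , x∈B ,
  λ y≢x y∈A y∈B → empty (_ , ∈-⊖⁺ (x∈p∩q⁺ (y∈A , y∈B)) y≢x))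
meetOutside? x 𝓕 | no none = inj₁ outside′
  where
  outside′ : MeetOutside x 𝓕
  outside′ {A} {B} A∈ B∈ x∈A x∈B with nonempty? ((A ∩ B) ⊖ x)
  ... | no  empty    = contradiction (lose A∈ (lose B∈ (x∈A , x∈B , empty))) none
  ... | yes (y , y∈) = let y∈A , y∈B = x∈p∩q⁻ A B (∈-⊖⁻ y∈) in
    y , ∈-⊖⇒≢ {A = A ∩ B} y∈ , y∈A , y∈B

-- The induction step shared by the Erdős-Ko-Rado theorem and the claw bound. Only the sets missing
-- `x` are assumed to intersect, because contracting an edge need not keep the whole family
-- intersecting.
split-bound : ∀ {m} {v x : Fin m} {Adm Adm₀ Adm₁ : Pred (Subset m) 0ℓ} {r} {𝓕 : Family m} →
  Unique 𝓕 →
  (∀ {A} → A ∈ˡ 𝓕 → Adm A × ∣ A ∣ ≡ suc r) →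
  PairwiseIntersecting (Split.without x 𝓕) →
  MeetOutside x 𝓕 →
  (∀ {A} → Adm A → x ∉ A → Adm₀ A) →
  (∀ {A} → Adm A → x ∈ A → Adm₁ (A ⊖ x)) →
  (∀ {A} → Adm₀ A → Adm A × x ∉ A) →
  (∀ {A} → Adm₁ A → Adm (A ⊕ x) × x ∉ A) →
  (∀ {𝓖} → IntersectingFamily Adm₀ (suc r) 𝓖 → StarBound v Adm₀ (suc r) 𝓖) →
  (∀ {𝓖} → IntersectingFamily Adm₁ r 𝓖 → StarBound v Adm₁ r 𝓖) →
  StarBound v Adm (suc r) 𝓕
split-bound {x = x} {Adm₁ = Adm₁} {r} {𝓕} 𝓕! snd int mo res₀ res₁ adm₀ adm₁ bound₀ bound₁ =
  glue {𝓕 = 𝓕} adm₀ adm₁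
    (bound₀ record
      { unique       = without-unique 𝓕!
      ; sound        = λ A∈ → let A∈𝓕 , x∉A = without⁻ A∈ ; adm , size = snd A∈𝓕 in res₀ adm x∉A , size
      ; intersecting = int })
    (bound₁ record
      { unique       = link-unique 𝓕!
      ; sound        = link-sound
      ; intersecting = link-intersecting mo })
  where
  open Split x 𝓕
  link-sound : ∀ {B} → B ∈ˡ link → Adm₁ B × ∣ B ∣ ≡ r
  link-sound B∈ with link⁻ B∈
  ... | A , A∈ , x∈A , refl = let adm , size = snd A∈ in
    res₁ adm x∈A , suc-injective (trans (∣A⊖x∣ x∈A) size)

module _ {m} {x i : Fin m} (x≢i : x ≢ i) {𝓕 : Family m} where
  open Compression x≢i {P = λ _ → Unit} (λ _ → yes tt) 𝓕

  compress-within : ∀ {S r} → i ∈ S → IntersectingFamily (_⊆ S) r 𝓕 →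
    IntersectingFamily (_⊆ S) r compress
  compress-within {S} {r} i∈S fam = record
    { unique       = compress-unique (unique fam)
    ; sound        = snd
    ; intersecting = λ A∈ B∈ → let y , y∈A , y∈B = int A∈ B∈ in y , x∈p∩q⁺ (y∈A , y∈B)
    }
    where
    snd : ∀ {A} → A ∈ˡ compress → A ⊆ S × ∣ A ∣ ≡ r
    snd A∈ with compress⁻ A∈
    ... | inj₁ (A∈𝓕 , _) = sound fam A∈𝓕
    ... | inj₂ (B , B∈ , (x∈B , i∉B , _) , refl) = let B⊆S , size = sound fam B∈ in
      (λ y∈ → [ (λ { refl → i∈S }) , B⊆S ∘ proj₁ ]′ (∈-shift⁻ x≢i y∈)) ,
      trans (∣shift∣ x≢i x∈B i∉B) size

    mixed : ∀ {A B} → A ∈ˡ 𝓕 → ¬ Moves A → B ∈ˡ 𝓕 → Moves B → ∃[ y ] y ∈ A × y ∈ shift x i B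
    mixed {A} {B} A∈ stay B∈ (x∈B , i∉B , _ , _) with meets fam A∈ B∈
    ... | y , y∈A , y∈B with y ≟ᶠ x | i ∈? A
    ...   | no  y≢x  | _       = y , y∈A , ∈-shift⁺ x≢i y∈B y≢x
    ...   | yes refl | yes i∈A = i , i∈A , x∈A⊕x (B ⊖ x) i
    -- `A` can have stayed only because its shift is already present. That shift meets `B` in a
    -- point other than `x` and `i`, which lies in `A` and survives the shift of `B`.
    ...   | yes refl | no  i∉A with shift x i A ∈ᶠ? 𝓕
    ...     | no  s∉ = contradiction (y∈A , i∉A , tt , s∉) stay
    ...     | yes s∈ with meets fam s∈ B∈
    ...       | z , z∈s , z∈B with ∈-shift⁻ x≢i z∈s
    ...         | inj₁ refl        = contradiction z∈B i∉B
    ...         | inj₂ (z∈A , z≢x) = z , z∈A , ∈-shift⁺ x≢i z∈B z≢x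

    int : ∀ {A B} → A ∈ˡ compress → B ∈ˡ compress → ∃[ y ] y ∈ A × y ∈ B
    int A∈ B∈ with compress⁻ A∈ | compress⁻ B∈
    ... | inj₁ (A∈ , _)          | inj₁ (B∈ , _)             = meets fam A∈ B∈
    ... | inj₁ (A∈ , stay)       | inj₂ (B , B∈ , mv , refl) = mixed A∈ stay B∈ mv
    ... | inj₂ (A , A∈ , mv , refl) | inj₁ (B∈ , stay)       =
      let y , y∈B , y∈s = mixed B∈ stay A∈ mv in y , y∈s , y∈B
    ... | inj₂ (A , _ , _ , refl) | inj₂ (B , _ , _ , refl)  =
      i , x∈A⊕x (A ⊖ x) i , x∈A⊕x (B ⊖ x) i

  -- No set gains `x` and `A` loses it, so the number of sets through `x` is a measure for repeated
  -- compression.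
  compress-decreases : ∀ {A} → Unique 𝓕 → A ∈ˡ 𝓕 → Moves A →
    length (filter (x ∈?_) compress) < length (filter (x ∈?_) 𝓕)
  compress-decreases {A} 𝓕! A∈ mv@(x∈A , _) = Unique-⊆⇒length≤
    (All.tabulate fresh ∷ Unique.filter⁺ (x ∈?_) (compress-unique 𝓕!))
    (λ { (here refl) → ∈-filter⁺ (x ∈?_) A∈ x∈A
       ; (there B∈)  → let B∈′ , x∈B = ∈-filter⁻ (x ∈?_) B∈ in
                       ∈-filter⁺ (x ∈?_) (proj₁ (stays B∈′ x∈B)) x∈B })
    where
    stays : ∀ {B} → B ∈ˡ compress → x ∈ B → B ∈ˡ 𝓕 × ¬ Moves B
    stays B∈ x∈B with compress⁻ B∈
    ... | inj₁ kept                = kept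
    ... | inj₂ (_ , _ , _ , refl) = contradiction x∈B (x∉shift x≢i)
    fresh : ∀ {B} → B ∈ˡ filter (x ∈?_) compress → A ≢ B
    fresh B∈ refl = let A∈′ , _ = ∈-filter⁻ (x ∈?_) B∈ in proj₂ (stays A∈′ x∈A) mv

-- If `A` and `B` meet only in `x`, then `A ∪ B` has at most `2 * r` points, so some `i` in `S` lies
-- outside both. The shift of `A` to `i` would be disjoint from `B`, hence is not in the family, and
-- `A` moves. The point `i` may change from round to round.
shifted-family : ∀ {m} (x : Fin m) {S r} → 2 * r < ∣ S ∣ →
  ∀ {𝓕} → IntersectingFamily (_⊆ S) r 𝓕 →
  ∃[ 𝓖 ] IntersectingFamily (_⊆ S) r 𝓖 × length 𝓖 ≡ length 𝓕 × MeetOutside x 𝓖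
shifted-family x {S} {r} 2r<∣S∣ {𝓕} fam =
  <-rec (λ k → ∀ {𝓕} → length (filter (x ∈?_) 𝓕) ≡ k → Goal 𝓕) step _ {𝓕} refl fam
  where
  Goal : Family _ → Set
  Goal 𝓕 = IntersectingFamily (_⊆ S) r 𝓕 →
    ∃[ 𝓖 ] IntersectingFamily (_⊆ S) r 𝓖 × length 𝓖 ≡ length 𝓕 × MeetOutside x 𝓖
  step : ∀ k → (∀ {j} → j < k → ∀ {𝓕} → length (filter (x ∈?_) 𝓕) ≡ j → Goal 𝓕) →
    ∀ {𝓕} → length (filter (x ∈?_) 𝓕) ≡ k → Goal 𝓕
  step k rec {𝓕} refl fam with meetOutside? x 𝓕
  ... | inj₁ mo = 𝓕 , fam , refl , mo
  ... | inj₂ (A , B , A∈ , B∈ , x∈A , x∈B , disj)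
    with sound fam A∈ | sound fam B∈
  ...   | _ , refl | _ , ∣B∣≡r
    with <∣S∣⇒∃∉ {S = S} {A ∪ B} (begin-strict
         ∣ A ∪ B ∣         ≤⟨ ∣A∪B∣≤∣A∣+∣B∣ A B ⟩
         ∣ A ∣ + ∣ B ∣     ≡⟨ cong (∣ A ∣ +_) (trans ∣B∣≡r (sym (+-identityʳ _))) ⟩
         2 * ∣ A ∣         <⟨ 2r<∣S∣ ⟩
         ∣ S ∣             ∎)
    where open ≤-Reasoning
  ...   | i , i∈S , i∉A∪B =
    let 𝓖 , fam′ , len , mo = rec (compress-decreases x≢i (unique fam) A∈ moves) refl
                                (compress-within x≢i i∈S fam)
    in 𝓖 , fam′ , trans len length-compress , mo
    where
    i∉A : i ∉ A
    i∉A = i∉A∪B ∘ x∈p∪q⁺ ∘ inj₁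
    i∉B : i ∉ B
    i∉B = i∉A∪B ∘ x∈p∪q⁺ ∘ inj₂
    x≢i : x ≢ i
    x≢i refl = i∉A x∈A
    open Compression x≢i {P = λ _ → Unit} (λ _ → yes tt) 𝓕
    moves : Moves A
    moves = x∈A , i∉A , tt , λ s∈ → let y , y∈s , y∈B = meets fam s∈ B∈ in
      [ (λ y≡i → i∉B (subst (_∈ B) y≡i y∈B)) , (λ { (y∈A , y≢x) → disj y≢x y∈A y∈B }) ]′ (∈-shift⁻ x≢i y∈s)

-- An intersecting family contains at most one set of each complementary pair.
ekr-2r : ∀ {m} {S : Subset m} {r v 𝓕} → ∣ S ∣ ≡ 2 * r → v ∈ S →
  IntersectingFamily (_⊆ S) r 𝓕 → StarBound v (_⊆ S) r 𝓕
ekr-2r {m} {S} {r} {v} {𝓕} ∣S∣≡2r v∈S fam = starBound (map toStar 𝓕)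
  (Unique-map-on inj (unique fam)) snd (≤-reflexive (sym (length-map toStar 𝓕)))
  where
  toStar : Subset m → Subset m
  toStar A with v ∈? A
  ... | yes _ = A
  ... | no  _ = S ∩ ∁ A
  snd : ∀ {B} → B ∈ˡ map toStar 𝓕 → B ⊆ S × ∣ B ∣ ≡ r × v ∈ B
  snd B∈ with ∈-map⁻ toStar B∈
  ... | A , A∈ , refl with v ∈? A | sound fam A∈
  ...   | yes v∈A | A⊆S , size = A⊆S , size , v∈A
  ...   | no  v∉A | A⊆S , size = proj₁ ∘ x∈p∩q⁻ S (∁ A) ,
    +-cancelʳ-≡ ∣ A ∣ _ r (trans (∣S∩∁A∣+∣A∣ S A A⊆S)
      (trans ∣S∣≡2r (cong (r +_) (trans (+-identityʳ r) (sym size))))) ,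
    x∈p∩q⁺ (v∈S , x∉p⇒x∈∁p v∉A)
  complement-not-in : ∀ {A} → A ∈ˡ 𝓕 → S ∩ ∁ A ∉ˡ 𝓕
  complement-not-in {A} A∈ A′∈ = let y , y∈A , y∈A′ = meets fam A∈ A′∈ in
    x∈p⇒x∉∁p y∈A (proj₂ (x∈p∩q⁻ S (∁ A) y∈A′))
  complement-⊆ : ∀ {A B} → A ∈ˡ 𝓕 → S ∩ ∁ A ≡ S ∩ ∁ B → A ⊆ B
  complement-⊆ {A} {B} A∈ eq {y} y∈A with y ∈? B
  ... | yes y∈B = y∈B
  ... | no  y∉B = contradiction
    (proj₂ (x∈p∩q⁻ S (∁ A) (subst (y ∈_) (sym eq) (x∈p∩q⁺ (proj₁ (sound fam A∈) y∈A , x∉p⇒x∈∁p y∉B)))))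
    (x∈p⇒x∉∁p y∈A)
  inj : ∀ {A B} → A ∈ˡ 𝓕 → B ∈ˡ 𝓕 → toStar A ≡ toStar B → A ≡ B
  inj {A} {B} A∈ B∈ eq with v ∈? A | v ∈? B
  ... | yes _ | yes _ = eq
  ... | yes _ | no  _ = contradiction (subst (_∈ˡ 𝓕) eq A∈) (complement-not-in B∈)
  ... | no  _ | yes _ = contradiction (subst (_∈ˡ 𝓕) (sym eq) B∈) (complement-not-in A∈)
  ... | no  _ | no  _ = ⊆-antisym (complement-⊆ A∈ eq) (complement-⊆ B∈ (sym eq))

-- Induction on the size of `S`. When `2 * r` is smaller than that size, one point `x` is deleted
-- after compressing there; both parts live on `S ⊖ x`, and strictness preserves the inequality.
erdős-ko-rado : ∀ k {m} {S : Subset m} {r v 𝓕} → ∣ S ∣ ≡ k → 2 * r ≤ k → v ∈ S →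
  IntersectingFamily (_⊆ S) r 𝓕 → StarBound v (_⊆ S) r 𝓕
erdős-ko-rado k {r = zero} _ _ _ fam = empty-family (no-empty-sets (intersecting fam) (proj₂ ∘ sound fam))
erdős-ko-rado k {S = S} {r = suc r} {v} ∣S∣≡k 2r≤k v∈S fam with m≤n⇒m<n∨m≡n 2r≤k
... | inj₂ 2r≡k = ekr-2r (trans ∣S∣≡k (sym 2r≡k)) v∈S fam
erdős-ko-rado (suc k) {S = S} {r = suc r} {v} ∣S∣≡k 2r≤k v∈S fam | inj₁ 2r<k
  -- The point to delete must differ from the centre `v`.
  with <∣S∣⇒∃∉ {S = S} {⁅ v ⁆} (begin-strict
    ∣ ⁅ v ⁆ ∣    ≡⟨ ∣⁅x⁆∣≡1 v ⟩
    1            <⟨ s≤s (≤-trans (s≤s z≤n) (s≤s⁻¹ 2r<k)) ⟩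
    suc k        ≡⟨ sym ∣S∣≡k ⟩
    ∣ S ∣        ∎)
  where open ≤-Reasoning
... | x , x∈S , x∉⁅v⁆ with shifted-family x {r = suc r} (subst (2 * suc r <_) (sym ∣S∣≡k) 2r<k) fam
...   | 𝓖 , fam′ , len , mo = starBound-≡ len (split-bound
  {Adm = _⊆ S} {Adm₀ = _⊆ S ⊖ x} {Adm₁ = _⊆ S ⊖ x} {𝓕 = 𝓖}
  (unique fam′) (sound fam′) (without-intersecting (intersecting fam′)) mo
  (λ A⊆ x∉A y∈A → ∈-⊖⁺ (A⊆ y∈A) λ { refl → x∉A y∈A })
  (λ {A} A⊆ x∈A y∈ → ∈-⊖⁺ (A⊆ (∈-⊖⁻ y∈)) (∈-⊖⇒≢ {A = A} y∈))
  (λ A⊆ → (λ y∈ → ∈-⊖⁻ (A⊆ y∈)) , (λ x∈ → x∉A⊖x S x (A⊆ x∈)))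
  (λ A⊆ → (λ y∈ → [ (λ { refl → x∈S }) , (λ y∈A → ∈-⊖⁻ (A⊆ y∈A)) ]′ (∈-⊕⁻ y∈)) ,
          (λ x∈ → x∉A⊖x S x (A⊆ x∈)))
  (erdős-ko-rado k ∣S⊖x∣≡k (s≤s⁻¹ 2r<k) v∈S⊖x)
  (erdős-ko-rado k ∣S⊖x∣≡k (≤-trans (*-monoʳ-≤ 2 (n≤1+n r)) (s≤s⁻¹ 2r<k)) v∈S⊖x))
  where
  open Split x 𝓖
  ∣S⊖x∣≡k : ∣ S ⊖ x ∣ ≡ k
  ∣S⊖x∣≡k = suc-injective (trans (∣A⊖x∣ x∈S) ∣S∣≡k)
  v∈S⊖x : v ∈ S ⊖ x
  v∈S⊖x = ∈-⊖⁺ v∈S λ { refl → x∉⁅v⁆ (x∈⁅x⁆ v) }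

-- Intersecting singletons coincide. Size one is a separate case for claws because the singleton of
-- the root is independent, while larger sets can be forced to avoid the root of a star.
singletons-bound : ∀ {m} {v : Fin m} {Adm} {𝓕 : Family m} → Adm ⁅ v ⁆ →
  IntersectingFamily Adm 1 𝓕 → StarBound v Adm 1 𝓕
singletons-bound {v = v} {Adm} {𝓕} adm fam = starBound [ ⁅ v ⁆ ] ([] ∷ [])
  (λ { (here refl) → adm , ∣⁅x⁆∣≡1 v , x∈⁅x⁆ v })
  (at-most-one (unique fam) λ A∈ B∈ → ⊆-antisym (included A∈ B∈) (included B∈ A∈))
  where
  at-most-one : ∀ {𝓖 : Family _} → Unique 𝓖 → (∀ {A B} → A ∈ˡ 𝓖 → B ∈ˡ 𝓖 → A ≡ B) → length 𝓖 ≤ 1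
  at-most-one []                       _    = z≤n
  at-most-one (_ ∷ [])                 _    = s≤s z≤n
  at-most-one ((A≢B ∷ _) ∷ (_ ∷ _)) same = contradiction (same (here refl) (there (here refl))) A≢B
  sole : ∀ {A y z} → A ∈ˡ 𝓕 → y ∈ A → z ∈ A → z ≡ y
  sole {A} {y} {z} A∈ y∈ z∈ with z ≟ᶠ y
  ... | yes z≡y = z≡y
  ... | no  z≢y = contradiction
    (trans (∣A⊖x∣ (∈-⊖⁺ z∈ z≢y)) (suc-injective (trans (∣A⊖x∣ y∈) (proj₂ (sound fam A∈))))) λ ()
  included : ∀ {A B} → A ∈ˡ 𝓕 → B ∈ˡ 𝓕 → A ⊆ B
  included A∈ B∈ z∈A with meets fam A∈ B∈
  ... | y , y∈A , y∈B with sole A∈ y∈A z∈A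
  ...   | refl = y∈B

-- Intersecting families of independent sets in elongated claws

record RootedClaw {m} (G : Graph m) (c v : Fin m) : Set where
  open Graph G
  field
    height          : Fin m → ℕ
    height-root     : height c ≡ 0
    height≡0        : ∀ {u} → height u ≡ 0 → u ≡ c
    parent          : ∀ {u} → u ≢ c → ∃[ p ] Adj u p × height u ≡ suc (height p)
    -- Neighbours of equal height are included; together with `parent` this rules out edges within a
    -- level.
    lower-unique    : ∀ {u p q} → Adj u p → Adj u q → height p ≤ height u → height q ≤ height u → p ≡ q
    two-neighbours  : ∀ {u p q w} → u ≢ c → Adj u p → Adj u q → p ≢ q → Adj u w → w ≡ p ⊎ w ≡ q
    v∼c             : Adj v c
    v-leaf          : ∀ {w} → Adj v w → w ≡ c

module _ {m} {G : Graph m} {c v : Fin m} (claw : RootedClaw G c v) where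
  open Graph G
  open RootedClaw claw

  root≤ : ∀ {u} → height c ≤ height u
  root≤ {u} = subst (_≤ height u) (sym height-root) z≤n

  ≰1⇒≢root : ∀ {u} → ¬ height u ≤ 1 → u ≢ c
  ≰1⇒≢root h≰1 refl = h≰1 (≤-trans (≤-reflexive height-root) z≤n)

  ≰1⇒parent≢root : ∀ {u p} → ¬ height u ≤ 1 → height u ≡ suc (height p) → p ≢ c
  ≰1⇒parent≢root h≰1 eq refl = h≰1 (≤-reflexive (trans eq (cong suc height-root)))

  v≢c : v ≢ c
  v≢c refl = irrefl v∼c

  Adm : Subset m → Pred (Subset m) 0ℓ
  Adm S A = A ⊆ S × Independent G A

  ⁅v⁆-adm : ∀ {S} → v ∈ S → Adm S ⁅ v ⁆
  ⁅v⁆-adm v∈S = (λ y∈ → subst (_∈ _) (sym (x∈⁅y⁆⇒x≡y v y∈)) v∈S) , ind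
    where
    ind : Independent G ⁅ v ⁆
    ind x y x∈ y∈ with x∈⁅y⁆⇒x≡y v x∈ | x∈⁅y⁆⇒x≡y v y∈
    ... | refl | refl = irrefl

  -- S is closed downwards, and L consists of leaves of the subgraph induced on S, other than c.
  record Trunk (S L : Subset m) : Set where
    field
      root∈S : c ∈ S
      v∈S    : v ∈ S
      closed : ∀ {x y} → x ∈ S → Adj x y → height y ≤ height x → y ∈ S
      tip∈S  : ∀ {u} → u ∈ L → u ∈ S
      tip≢c  : ∀ {u} → u ∈ L → u ≢ c
      tip-top : ∀ {u w} → u ∈ L → w ∈ S → Adj u w → height w ≤ height u

  open Trunk

  star-bound : ∀ {S L r 𝓕} → Trunk S L → (∀ {x} → x ∈ S → height x ≤ 1) → 2 * (2 + r) ≤ ∣ L ∣ →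
    IntersectingFamily (Adm S) (2 + r) 𝓕 → StarBound v (Adm S) (2 + r) 𝓕
  star-bound {S} {L} {r} {𝓕} T low 2r≤ fam =
    starBound-map {Adm = _⊆ S ⊖ c} (λ A⊆ → (λ y∈ → ∈-⊖⁻ (A⊆ y∈)) , ind A⊆)
      (erdős-ko-rado _ refl 2r≤∣S⊖c∣ (∈-⊖⁺ (v∈S T) v≢c) record
        { unique = unique fam ; sound = avoids ; intersecting = intersecting fam })
    where
    ∼c : ∀ {x} → x ∈ S → x ≢ c → Adj x c
    ∼c {x} x∈S x≢c with parent x≢c
    ... | p , x∼p , eq with height≡0 (n≤0⇒n≡0 (s≤s⁻¹ (≤-trans (≤-reflexive (sym eq)) (low x∈S))))
    ...   | refl = x∼p
    2r≤∣S⊖c∣ : 2 * (2 + r) ≤ ∣ S ⊖ c ∣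
    2r≤∣S⊖c∣ = ≤-trans 2r≤ (p⊆q⇒∣p∣≤∣q∣ {p = L} λ u∈ → ∈-⊖⁺ (tip∈S T u∈) (tip≢c T u∈))
    avoids : ∀ {A} → A ∈ˡ 𝓕 → A ⊆ S ⊖ c × ∣ A ∣ ≡ 2 + r
    avoids {A} A∈ with sound fam A∈
    ... | (A⊆S , indA) , size = (λ y∈ → ∈-⊖⁺ (A⊆S y∈) λ { refl → c∉A y∈ }) , size
      where
      c∉A : c ∉ A
      c∉A c∈A with <∣S∣⇒∃∉ {S = A} {⁅ c ⁆} (subst (_< ∣ A ∣) (sym (∣⁅x⁆∣≡1 c)) (subst (1 <_) (sym size) (s≤s (s≤s z≤n))))
      ... | u , u∈A , u∉ = indA u c u∈A c∈A (∼c (A⊆S u∈A) λ { refl → u∉ (x∈⁅x⁆ c) })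
    ind : ∀ {A} → A ⊆ S ⊖ c → Independent G A
    ind A⊆ x y x∈ y∈ x∼y with ∈-⊖⇒≢ {A = S} (A⊆ x∈) | ∈-⊖⇒≢ {A = S} (A⊆ y∈) | ∈-⊖⁻ (A⊆ x∈) | ∈-⊖⁻ (A⊆ y∈)
    -- The higher of two adjacent vertices other than `c` would have two distinct neighbours no
    -- higher than itself, namely the other vertex and `c`.
    ... | x≢c | y≢c | x∈S | y∈S with ≤-total (height x) (height y)
    ...   | inj₁ x≤y = x≢c (lower-unique (symm x∼y) (∼c y∈S y≢c) x≤y root≤)
    ...   | inj₂ y≤x = y≢c (lower-unique x∼y (∼c x∈S x≢c) y≤x root≤)


  -- Here `d`, `b`, `a` end a limb of the subgraph induced on `S`: maximal height leaves `a` only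
  -- the neighbour `b` in `S`, and `b ≢ c` leaves `b` only `a` and `d`. The vertex `v` is neither
  -- `a` nor `b`, since its sole neighbour is `c`.
  module Step {S L : Subset m} (T : Trunk S L) {a b d : Fin m}
    (a∈S : a ∈ S) (highest : ∀ {x} → x ∈ S → height x ≤ height a)
    (a≢c : a ≢ c) (b≢c : b ≢ c)
    (a∼b : Adj a b) (h[a] : height a ≡ suc (height b))
    (b∼d : Adj b d) (h[b] : height b ≡ suc (height d)) where

    b≤a : height b ≤ height a
    b≤a = ≤-trans (n≤1+n _) (≤-reflexive (sym h[a]))

    d≤b : height d ≤ height b
    d≤b = ≤-trans (n≤1+n _) (≤-reflexive (sym h[b]))

    a≰b : ¬ height a ≤ height b
    a≰b = <⇒≱ (≤-reflexive (sym h[a]))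

    a≢b : a ≢ b
    a≢b refl = irrefl a∼b

    a≢d : a ≢ d
    a≢d refl = a≰b d≤b

    N[a] : ∀ {x} → x ∈ S → Adj a x → x ≡ b
    N[a] x∈S a∼x = lower-unique a∼x a∼b (highest x∈S) b≤a

    N[b] : ∀ {x} → Adj b x → x ≡ a ⊎ x ≡ d
    N[b] = two-neighbours b≢c (symm a∼b) b∼d a≢d

    v≢a : v ≢ a
    v≢a refl = b≢c (v-leaf a∼b)

    v≢b : v ≢ b
    v≢b refl = a≢c (v-leaf (symm a∼b))

    b∈S : b ∈ S
    b∈S = closed T a∈S a∼b b≤a

    b∉L : b ∉ L
    b∉L b∈L = a≰b (tip-top T b∈L a∈S (symm a∼b))

    -- Once `a` is gone, `b` is a tip and takes its place, so no tip is lost.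
    trunk₀ : Trunk (S ⊖ a) (L ⊖ a ⊕ b)
    trunk₀ = record
      { root∈S  = ∈-⊖⁺ (root∈S T) (a≢c ∘ sym)
      ; v∈S     = ∈-⊖⁺ (v∈S T) v≢a
      ; closed  = λ x∈ x∼y y≤x → ∈-⊖⁺ (closed T (∈-⊖⁻ x∈) x∼y y≤x)
          λ { refl → let x∈S = ∈-⊖⁻ x∈ in
              a≰b (subst (λ z → height a ≤ height z) (N[a] x∈S (symm x∼y)) y≤x) }
      ; tip∈S   = λ u∈ → [ (λ { refl → ∈-⊖⁺ b∈S (a≢b ∘ sym) })
                         , (λ { (u∈L , u≢a) → ∈-⊖⁺ (tip∈S T u∈L) u≢a }) ]′ (∈-shift⁻ a≢b u∈)
      ; tip≢c   = λ u∈ → [ (λ { refl → b≢c }) , tip≢c T ∘ proj₁ ]′ (∈-shift⁻ a≢b u∈)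
      ; tip-top = λ u∈ w∈ u∼w → [
            (λ { refl → [ (λ { refl → contradiction w∈ (x∉A⊖x S a) }) , (λ { refl → d≤b }) ]′ (N[b] u∼w) })
          , (λ { (u∈L , _) → tip-top T u∈L (∈-⊖⁻ w∈) u∼w }) ]′ (∈-shift⁻ a≢b u∈)
      }

    -- The vertex `d` is not made a tip, as it may be `c`. At most the tip `a` is lost, which is
    -- affordable because the sets lose an element as well.
    trunk₁ : Trunk (S ⊖ a ⊖ b) (L ⊖ a)
    trunk₁ = record
      { root∈S  = ∈-⊖⁺ (Trunk.root∈S trunk₀) (b≢c ∘ sym)
      ; v∈S     = ∈-⊖⁺ (Trunk.v∈S trunk₀) v≢b
      ; closed  = λ {x} x∈ x∼y y≤x → ∈-⊖⁺ (Trunk.closed trunk₀ (∈-⊖⁻ x∈) x∼y y≤x)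
          λ { refl → [ (λ { refl → x∉A⊖x S a (∈-⊖⁻ x∈) })
                     , (λ { refl → <⇒≱ (≤-reflexive (sym h[b])) y≤x }) ]′ (N[b] (symm x∼y)) }
      ; tip∈S   = λ u∈ → ∈-⊖⁺ (∈-⊖⁺ (tip∈S T (∈-⊖⁻ u∈)) (∈-⊖⇒≢ {A = L} u∈)) λ { refl → b∉L (∈-⊖⁻ u∈) }
      ; tip≢c   = tip≢c T ∘ ∈-⊖⁻
      ; tip-top = λ u∈ w∈ → tip-top T (∈-⊖⁻ u∈) (∈-⊖⁻ (∈-⊖⁻ w∈))
      }

    ∣L∣≤∣L₀∣ : ∣ L ∣ ≤ ∣ L ⊖ a ⊕ b ∣
    ∣L∣≤∣L₀∣ = ≤-trans (∣A∣≤1+∣A⊖x∣ {A = L}) (≤-reflexive (sym (∣A⊕x∣ (b∉L ∘ ∈-⊖⁻))))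

    -- The shift inserts `b`, whose neighbours are `a`, which is removed, and `d`. This is why only
    -- sets missing `d` may move.
    shift-independent : ∀ {A} → d ∉ A → Independent G A → Independent G (shift a b A)
    shift-independent {A} d∉A ind x y x∈ y∈ x∼y with ∈-shift⁻ a≢b x∈ | ∈-shift⁻ a≢b y∈
    ... | inj₁ refl         | inj₁ refl         = irrefl x∼y
    ... | inj₂ (x∈A , _)    | inj₂ (y∈A , _)    = ind x y x∈A y∈A x∼y
    ... | inj₁ refl         | inj₂ (y∈A , y≢a)  = [ y≢a , (λ { refl → d∉A y∈A }) ]′ (N[b] x∼y)
    ... | inj₂ (x∈A , x≢a)  | inj₁ refl         = [ x≢a , (λ { refl → d∉A x∈A }) ]′ (N[b] (symm x∼y))

    add-independent : ∀ {A} → A ⊆ S ⊖ a ⊖ b → Independent G A → Independent G (A ⊕ a)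
    add-independent {A} A⊆ ind x y x∈ y∈ x∼y with ∈-⊕⁻ x∈ | ∈-⊕⁻ y∈
    ... | inj₁ refl | inj₁ refl = irrefl x∼y
    ... | inj₂ x∈A  | inj₂ y∈A  = ind x y x∈A y∈A x∼y
    ... | inj₁ refl | inj₂ y∈A  = not-adjacent y∈A x∼y
      where
      not-adjacent : ∀ {y} → y ∈ A → ¬ Adj a y
      not-adjacent y∈A a∼y = ∈-⊖⇒≢ {A = S ⊖ a} (A⊆ y∈A) (N[a] (∈-⊖⁻ (∈-⊖⁻ (A⊆ y∈A))) a∼y)
    ... | inj₂ x∈A  | inj₁ refl = ∈-⊖⇒≢ {A = S ⊖ a} (A⊆ x∈A) (N[a] (∈-⊖⁻ (∈-⊖⁻ (A⊆ x∈A))) (symm x∼y))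

    module _ {r} {𝓕 : Family m} (fam : IntersectingFamily (Adm S) (suc r) 𝓕) where
      open Compression a≢b (λ A → ¬? (d ∈? A)) 𝓕
      open Split a compress

      sound-compress : ∀ {A} → A ∈ˡ compress → Adm S A × ∣ A ∣ ≡ suc r
      sound-compress A∈ with compress⁻ A∈
      ... | inj₁ (A∈𝓕 , _) = sound fam A∈𝓕
      ... | inj₂ (B , B∈ , (a∈B , b∉B , d∉B , _) , refl) = let (B⊆S , ind) , size = sound fam B∈ in
        ((λ y∈ → [ (λ { refl → b∈S }) , B⊆S ∘ proj₁ ]′ (∈-shift⁻ a≢b y∈)) , shift-independent d∉B ind) ,
        trans (∣shift∣ a≢b a∈B b∉B) size

      meet-shift : ∀ {A B} → A ∈ˡ 𝓕 → a ∉ A → B ∈ˡ 𝓕 → ∃[ y ] y ∈ A × y ∈ shift a b B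
      meet-shift A∈ a∉A B∈ = let y , y∈A , y∈B = meets fam A∈ B∈ in
        y , y∈A , ∈-shift⁺ a≢b y∈B λ { refl → a∉A y∈A }

      -- Two moved sets share `b`. A kept set without `a` meets any other original set away from
      -- `a`, and the shift preserves that common point.
      without-meet : ∀ {A B} → A ∈ˡ without → B ∈ˡ without → ∃[ y ] y ∈ A × y ∈ B
      without-meet A∈ B∈ with without⁻ A∈ | without⁻ B∈
      ... | A∈′ , a∉A | B∈′ , a∉B with compress⁻ A∈′ | compress⁻ B∈′
      ...   | inj₁ (A∈𝓕 , _)        | inj₁ (B∈𝓕 , _)        = meets fam A∈𝓕 B∈𝓕
      ...   | inj₁ (A∈𝓕 , _)        | inj₂ (B , B∈𝓕 , _ , refl) = meet-shift A∈𝓕 a∉A B∈𝓕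
      ...   | inj₂ (A , A∈𝓕 , _ , refl) | inj₁ (B∈𝓕 , _)    =
        let y , y∈B , y∈s = meet-shift B∈𝓕 a∉B A∈𝓕 in y , y∈s , y∈B
      ...   | inj₂ (A , _ , _ , refl) | inj₂ (B , _ , _ , refl) =
        b , x∈A⊕x (A ⊖ a) b , x∈A⊕x (B ⊖ a) b

      -- A set still containing `a` was prevented from moving, and never by `b ∈ A`, since `a` and
      -- `b` are adjacent.
      stays : ∀ {A} → A ∈ˡ compress → a ∈ A → A ∈ˡ 𝓕 × (d ∈ A ⊎ shift a b A ∈ˡ 𝓕) × b ∉ A
      stays {A} A∈ a∈A with compress⁻ A∈
      ... | inj₂ (_ , _ , _ , refl) = contradiction a∈A (x∉shift a≢b)
      ... | inj₁ (A∈𝓕 , stay) = A∈𝓕 , why , b∉A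
        where
        b∉A : b ∉ A
        b∉A b∈A = proj₂ (proj₁ (sound fam A∈𝓕)) a b a∈A b∈A a∼b
        why : d ∈ A ⊎ shift a b A ∈ˡ 𝓕
        why with d ∈? A | shift a b A ∈ᶠ? 𝓕
        ... | yes d∈A | _      = inj₁ d∈A
        ... | no  _   | yes s∈ = inj₂ s∈
        ... | no  d∉A | no  s∉ = contradiction (a∈A , b∉A , d∉A , s∉) stay

      -- Two sets through a either both contain d, or one of them may be replaced by its shift,
      -- which meets the other outside {a, b}.
      meet-outside : MeetOutside a compress
      meet-outside A∈ B∈ a∈A a∈B with stays A∈ a∈A | stays B∈ a∈B
      ... | _ , inj₁ d∈A , _     | _ , inj₁ d∈B , _     = d , a≢d ∘ sym , d∈A , d∈B
      ... | A∈𝓕 , _ , b∉A        | B∈𝓕 , inj₂ s∈ , _    =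
        let y , y∈A , y∈s = meets fam A∈𝓕 s∈ in
        [ (λ y≡b → contradiction (subst (_∈ _) y≡b y∈A) b∉A) ,
          (λ { (y∈B , y≢a) → y , y≢a , y∈A , y∈B }) ]′ (∈-shift⁻ a≢b y∈s)
      ... | A∈𝓕 , inj₂ s∈ , _    | B∈𝓕 , _ , b∉B        =
        let y , y∈B , y∈s = meets fam B∈𝓕 s∈ in
        [ (λ y≡b → contradiction (subst (_∈ _) y≡b y∈B) b∉B) ,
          (λ { (y∈A , y≢a) → y , y≢a , y∈A , y∈B }) ]′ (∈-shift⁻ a≢b y∈s)

      step-bound :
        (∀ {𝓖} → IntersectingFamily (Adm (S ⊖ a)) (suc r) 𝓖 → StarBound v (Adm (S ⊖ a)) (suc r) 𝓖) →
        (∀ {𝓖} → IntersectingFamily (Adm (S ⊖ a ⊖ b)) r 𝓖 → StarBound v (Adm (S ⊖ a ⊖ b)) r 𝓖) →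
        StarBound v (Adm S) (suc r) 𝓕
      step-bound bound₀ bound₁ = starBound-≡ length-compress (split-bound
        {Adm = Adm S} {Adm₀ = Adm (S ⊖ a)} {Adm₁ = Adm (S ⊖ a ⊖ b)} {𝓕 = compress}
        (compress-unique (unique fam)) sound-compress
        (λ A∈ B∈ → let y , y∈A , y∈B = without-meet A∈ B∈ in y , x∈p∩q⁺ (y∈A , y∈B))
        meet-outside
        (λ (A⊆ , ind) a∉A → (λ y∈ → ∈-⊖⁺ (A⊆ y∈) λ { refl → a∉A y∈ }) , ind)
        -- An independent set through `a` misses `b`, so its link set lies in `S ⊖ a ⊖ b`.
        (λ {A} (A⊆ , ind) a∈A →
          (λ y∈ → ∈-⊖⁺ (∈-⊖⁺ (A⊆ (∈-⊖⁻ y∈)) (∈-⊖⇒≢ {A = A} y∈))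
                    λ { refl → ind a b a∈A (∈-⊖⁻ y∈) a∼b }) ,
          λ x y x∈ y∈ → ind x y (∈-⊖⁻ x∈) (∈-⊖⁻ y∈))
        (λ (A⊆ , ind) → ((λ y∈ → ∈-⊖⁻ (A⊆ y∈)) , ind) , λ a∈ → x∉A⊖x S a (A⊆ a∈))
        (λ (A⊆ , ind) →
          ((λ y∈ → [ (λ { refl → a∈S }) , (λ y∈A → ∈-⊖⁻ (∈-⊖⁻ (A⊆ y∈A))) ]′ (∈-⊕⁻ y∈)) ,
           add-independent A⊆ ind) ,
          λ a∈ → x∉A⊖x S a (∈-⊖⁻ (A⊆ a∈)))
        bound₀ bound₁)

  -- `k` merely bounds the size of `S`, because the two recursive calls delete one and two vertices.
  claw-bound : ∀ k {S L r 𝓕} → ∣ S ∣ ≤ k → Trunk S L → 2 * r ≤ ∣ L ∣ →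
    IntersectingFamily (Adm S) r 𝓕 → StarBound v (Adm S) r 𝓕
  claw-bound _ {r = 0} _ _ _ fam = empty-family (no-empty-sets (intersecting fam) (proj₂ ∘ sound fam))
  claw-bound _ {r = 1} _ T _ fam = singletons-bound (⁅v⁆-adm (v∈S T)) fam
  claw-bound k {S} {L} {r = suc (suc r)} ∣S∣≤k T 2r≤ fam with maximiser height {S} (c , root∈S T)
  ... | a , a∈S , highest with height a ≤? 1
  ...   | yes h≤1 = star-bound T (λ x∈ → ≤-trans (highest x∈) h≤1) 2r≤ fam
  claw-bound zero {S} ∣S∣≤k T 2r≤ fam | a , a∈S , _ | no _ =
    contradiction (≤-trans (≤-reflexive (∣A⊖x∣ a∈S)) ∣S∣≤k) λ ()
  claw-bound (suc k) {S} {L} {r = suc (suc r)} ∣S∣≤k T 2r≤ fam | a , a∈S , highest | no h≰1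
    with parent (≰1⇒≢root h≰1)
  ... | b , a∼b , h[a]
    with parent (≰1⇒parent≢root h≰1 h[a])
  ... | d , b∼d , h[b] = step-bound fam
    (claw-bound k (s≤s⁻¹ (≤-trans (≤-reflexive (∣A⊖x∣ a∈S)) ∣S∣≤k)) trunk₀ (≤-trans 2r≤ ∣L∣≤∣L₀∣))
    (claw-bound k (≤-trans (p⊆q⇒∣p∣≤∣q∣ {p = S ⊖ a ⊖ b} ∈-⊖⁻) (s≤s⁻¹ (≤-trans (≤-reflexive (∣A⊖x∣ a∈S)) ∣S∣≤k)))
      -- Twice the set size drops by two, while at most one tip disappears.
      trunk₁ (s≤s⁻¹ (≤-trans (≤-trans (*-monoʳ-< 2 (n<1+n (suc r))) 2r≤) (∣A∣≤1+∣A⊖x∣ {A = L}))))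
    where
    open Step T a∈S highest (≰1⇒≢root h≰1) (≰1⇒parent≢root h≰1 h[a]) a∼b h[a] b∼d h[b]

-- Distance from the root of a tree

least : ∀ {p} {P : Pred ℕ p} → Decidable P → ∀ n → P n → ∃[ k ] P k × (∀ {j} → P j → k ≤ j)
least P? zero    p = 0 , p , λ _ → z≤n
least P? (suc n) p with P? 0
... | yes p₀ = 0 , p₀ , λ _ → z≤n
... | no ¬p₀ with least (P? ∘ suc) n p
...   | k , pk , k≤ = suc k , pk , λ { {zero} p₀ → contradiction p₀ ¬p₀ ; {suc j} pj → s≤s (k≤ pj) }

module _ {m} (G : Graph m) where
  open Graph G

  Unique-neighbours≤degree : ∀ {u xs} → Unique xs → (∀ {x} → x ∈ˡ xs → Adj u x) → length xs ≤ degree G u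
  Unique-neighbours≤degree {u} xs! adj =
    Unique-⊆⇒length≤ xs! λ x∈ → ∈-filter⁺ (adj? u) (∈-allFin _) (adj x∈)

  sole-neighbour : ∀ {u p q} → degree G u ≡ 1 → Adj u p → Adj u q → p ≡ q
  sole-neighbour {u} {p} {q} deg u∼p u∼q with p ≟ᶠ q
  ... | yes p≡q = p≡q
  ... | no  p≢q = contradiction
    (Unique-neighbours≤degree ((p≢q ∷ []) ∷ [] ∷ [])
      λ { (here refl) → u∼p ; (there (here refl)) → u∼q })
    (<⇒≱ (s≤s (≤-reflexive deg)))

  path-suffix : ∀ {P : Pred (Fin m) 0ℓ} {x y z} (w : Walk G x y) →
    IsPath G w → All P (vertices G w) → z ∈ˡ vertices G w →
    ∃[ w′ ] IsPath G {z} {y} w′ × All P (vertices G w′)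
  path-suffix ε       w! Pw       (here refl) = ε , w! , Pw
  path-suffix (e ◅ w) w! Pw       (here refl) = e ◅ w , w! , Pw
  path-suffix (e ◅ w) (_ ∷ w!) (_ ∷ Pw) (there z∈) = path-suffix w w! Pw z∈

  AdjAvoiding : Fin m → Fin m → Fin m → Set
  AdjAvoiding a x y = Adj x y × x ≢ a × y ≢ a

  -- If the new first vertex already occurs on the path found so far, the suffix starting there is
  -- taken, which cuts out the loop.
  loop-erase : ∀ {a x y} → x ≢ a → Star (AdjAvoiding a) x y →
    ∃[ w ] IsPath G {x} {y} w × All (_≢ a) (vertices G w)
  loop-erase x≢a ε = ε , [] ∷ [] , x≢a ∷ []
  loop-erase {a} {x} x≢a ((x∼z , _ , z≢a) ◅ s) with loop-erase z≢a s
  ... | w , w! , avoid with x ∈ⁿ? vertices G w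
    where open DecMembership _≟ᶠ_ renaming (_∈?_ to _∈ⁿ?_)
  ...   | yes x∈ = path-suffix w w! avoid x∈
  ...   | no  x∉ = x∼z ◅ w , All.tabulate (λ { y∈ refl → x∉ y∈ }) ∷ w! , x≢a ∷ avoid

  -- Otherwise a path from `p` to `q` missing `a` would close up through `a` to a cycle.
  acyclic-neighbours : Acyclic G → ∀ {a p q} → Adj a p → Adj a q → Star (AdjAvoiding a) p q → p ≡ q
  acyclic-neighbours acyclic {a} {p} {q} a∼p a∼q s with loop-erase (λ { refl → irrefl a∼p }) s
  ... | ε      , _  , _     = refl
  ... | e ◅ w  , w! , avoid = contradiction (symm a∼q)
    (acyclic (a∼p ◅ e ◅ w) (All.map (λ x≢a → x≢a ∘ sym) avoid ∷ w!) (s≤s (s≤s z≤n)))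

module Heights {m} (G : Graph m) (c : Fin m) (tree : IsTree G) where
  open Graph G
  open IsTree tree

  -- Existence of a walk of length exactly `k` to the root, given by recursion so that it is
  -- decidable and a least length can be searched for.
  Reach : ℕ → Pred (Fin m) 0ℓ
  Reach zero    u = u ≡ c
  Reach (suc k) u = ∃[ w ] Adj u w × Reach k w

  reach? : ∀ k → Decidable (Reach k)
  reach? zero    u = u ≟ᶠ c
  reach? (suc k) u = any? λ w → adj? u w ×-dec reach? k w

  walk⇒reach : ∀ {u} (w : Walk G u c) → Reach (edgeCount G w) u
  walk⇒reach ε       = refl
  walk⇒reach (e ◅ w) = _ , e , walk⇒reach w

  distance : ∀ u → ∃[ k ] Reach k u × (∀ {j} → Reach j u → k ≤ j)
  distance u = least (λ k → reach? k u) _ (walk⇒reach (connected u c))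

  height : Fin m → ℕ
  height u = proj₁ (distance u)

  reach-height : ∀ u → Reach (height u) u
  reach-height u = proj₁ (proj₂ (distance u))

  height≤ : ∀ {u j} → Reach j u → height u ≤ j
  height≤ {u} = proj₂ (proj₂ (distance u))

  height-root : height c ≡ 0
  height-root = n≤0⇒n≡0 (height≤ refl)

  height≡0 : ∀ {u} → height u ≡ 0 → u ≡ c
  height≡0 {u} eq = subst (λ k → Reach k u) eq (reach-height u)

  height-parent : ∀ {u} → u ≢ c → ∃[ p ] Adj u p × height u ≡ suc (height p)
  height-parent {u} u≢c = go (height u) refl (reach-height u)
    where
    go : ∀ k → height u ≡ k → Reach k u → ∃[ p ] Adj u p × height u ≡ suc (height p)
    go zero    _  u≡c             = contradiction u≡c u≢c
    go (suc k) eq (p , u∼p , reach) = p , u∼p ,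
      ≤-antisym (height≤ (p , u∼p , reach-height p)) (≤-trans (s≤s (height≤ reach)) (≤-reflexive (sym eq)))

  -- Each step to a parent lowers the height, so after `p` every vertex is strictly lower than `a`
  -- and hence different from it.
  descend : ∀ {a} k {p} → height p ≡ k → p ≢ a → height p ≤ height a → Star (AdjAvoiding G a) p c
  descend k {p} eq p≢a p≤a with p ≟ᶠ c
  ... | yes refl = ε
  descend {a} k {p} eq p≢a p≤a | no p≢c with height-parent p≢c
  descend {a} zero eq _ _ | no _ | _ , _ , eq′ = contradiction (trans (sym eq) eq′) λ ()
  descend {a} (suc k) eq p≢a p≤a | no _ | q , p∼q , eq′ =
    (p∼q , p≢a , q≢a) ◅ descend k (suc-injective (trans (sym eq′) eq)) q≢a (<⇒≤ q<a)
    where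
    q<a : height q < height a
    q<a = ≤-trans (≤-reflexive (sym eq′)) p≤a
    q≢a : q ≢ a
    q≢a refl = <-irrefl refl q<a

  -- Both neighbours descend to the root without using `u`; joining the two descents links them in
  -- the graph without `u`.
  lower-unique : ∀ {u p q} → Adj u p → Adj u q → height p ≤ height u → height q ≤ height u → p ≡ q
  lower-unique {u} u∼p u∼q p≤u q≤u = acyclic-neighbours G acyclic u∼p u∼q
    (descend _ refl (λ { refl → irrefl u∼p }) p≤u ◅◅
     reverse (λ (x∼y , x≢a , y≢a) → symm x∼y , y≢a , x≢a)
       (descend _ refl (λ { refl → irrefl u∼q }) q≤u))

-- Elongated claws as rooted claws

module _ {m} {G : Graph m} {c : Fin m} (claw : IsElongatedClaw G c) where
  open Graph G
  open IsElongatedClaw claw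

  rootedClaw : ∀ {v} → degree G v ≡ 1 → Adj v c → RootedClaw G c v
  rootedClaw deg v∼c = record
    { height         = height
    ; height-root    = height-root
    ; height≡0       = height≡0
    ; parent         = height-parent
    ; lower-unique   = lower-unique
    ; two-neighbours = two-neighbours
    ; v∼c            = v∼c
    ; v-leaf         = λ v∼w → sole-neighbour G deg v∼w v∼c
    }
    where
    open Heights G c isTree
    two-neighbours : ∀ {u p q w} → u ≢ c → Adj u p → Adj u q → p ≢ q → Adj u w → w ≡ p ⊎ w ≡ q
    two-neighbours {u} {p} {q} {w} u≢c u∼p u∼q p≢q u∼w with w ≟ᶠ p | w ≟ᶠ q
    ... | yes w≡p | _       = inj₁ w≡p
    ... | no  _   | yes w≡q = inj₂ w≡q
    -- Three distinct neighbours contradict degree at most two.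
    ... | no  w≢p | no  w≢q = contradiction
      (Unique-neighbours≤degree G ((w≢p ∷ w≢q ∷ []) ∷ (p≢q ∷ []) ∷ [] ∷ [])
        λ { (here refl) → u∼w ; (there (here refl)) → u∼p ; (there (there (here refl))) → u∼q })
      (<⇒≱ (s≤s ([ (λ eq → ≤-trans (≤-reflexive eq) (s≤s z≤n)) , ≤-reflexive ]′ (degree-1-2 u u≢c))))

  short-limb-end : HasShortLimb G c → ∃[ v ] degree G v ≡ 1 × Adj v c
  short-limb-end (record { end = v ; isLeaf = deg ; walk = e ◅ ε } , refl) = v , deg , symm e

  -- A root of degree 1 whose only limb is short leaves room for two vertices only.
  leaves≤2 : ∀ {v} → degree G v ≡ 1 → Adj v c → degree G c ≡ 1 → length (leaves G) ≤ 2
  leaves≤2 {v} deg-v v∼c deg-c = Unique-⊆⇒length≤ {ys = c ∷ v ∷ []}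
    (Unique.filter⁺ _ (Unique.allFin⁺ m)) λ _ → reached (IsTree.connected isTree c _) (here refl)
    where
    reached : ∀ {z u} → Walk G z u → z ∈ˡ c ∷ v ∷ [] → u ∈ˡ c ∷ v ∷ []
    reached ε       z∈                  = z∈
    reached (e ◅ w) (here refl)         = reached w (there (here (sole-neighbour G deg-c e (symm v∼c))))
    reached (e ◅ w) (there (here refl)) = reached w (here (sole-neighbour G deg-v e v∼c))

-- From star bounds to the EKR property

fromList : ∀ {m} → List (Fin m) → Subset m
fromList []       = ⊥
fromList (x ∷ xs) = fromList xs ⊕ x

∈-fromList⁻ : ∀ {m} {xs} {u : Fin m} → u ∈ fromList xs → u ∈ˡ xs
∈-fromList⁻ {xs = []}     u∈ = contradiction u∈ ∉⊥
∈-fromList⁻ {xs = x ∷ xs} u∈ with ∈-⊕⁻ u∈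
... | inj₁ u≡x = here u≡x
... | inj₂ u∈′ = there (∈-fromList⁻ u∈′)

∣fromList∣ : ∀ {m} {xs : List (Fin m)} → Unique xs → ∣ fromList xs ∣ ≡ length xs
∣fromList∣ {m} []          = ∣⊥∣≡0 m
∣fromList∣     (x# ∷ xs!) = trans (∣A⊕x∣ λ x∈ → All.lookup x# (∈-fromList⁻ x∈) refl) (cong suc (∣fromList∣ xs!))

∈-subsets : ∀ {m} (A : Subset m) → A ∈ˡ subsets m
∈-subsets Vec.[]              = here refl
∈-subsets (inside  Vec.∷ A) = ∈-++⁺ˡ (∈-map⁺ _ (∈-subsets A))
∈-subsets (outside Vec.∷ A) = ∈-++⁺ʳ _ (∈-map⁺ _ (∈-subsets A))

-- The witnesses embed into the star at `v`, whose length is among those maximised in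
-- `largestStarSize`.
starBound⇒EKR : ∀ {m} (G : Graph m) {r v} {𝓕 : Family m} →
  StarBound v (Independent G) r 𝓕 → length 𝓕 ≤ largestStarSize G r
starBound⇒EKR {m} G {r} {v} (starBound T T! snd b) = ≤-trans b (≤-trans (Unique-⊆⇒length≤ T! ∈star)
  (v≤max⁺ 0 _ (inj₂ (lose (∈-map⁺ (length ∘ star G r) (∈-allFin v)) ≤-refl))))
  where
  ∈star : ∀ {A} → A ∈ˡ T → A ∈ˡ star G r v
  ∈star A∈ = let ind , size , v∈A = snd A∈ in
    ∈-filter⁺ (v ∈?_) (∈-filter⁺ (λ A → independent? G A ×-dec (∣ A ∣ ≟ r)) (∈-subsets _) (ind , size)) v∈A

theorem1p3 : (n r : ℕ) → 1 ≤ n → 1 ≤ r → n ≥ 2 * r →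
    ∀ {m} (G : Graph m) (root : Fin m) → IsElongatedClaw G root →
    length (leaves G) ≡ n → HasShortLimb G root →
    EKR r G
theorem1p3 n r _ 1≤r n≥2r {m} G root claw refl short 𝒜 𝒜! 𝒜⊆ int with short-limb-end claw short
... | v , deg-v , v∼root = starBound⇒EKR G (starBound-map proj₂ (bound r 1≤r n≥2r fam))
  where
  rooted : RootedClaw G root v
  rooted = rootedClaw claw deg-v v∼root
  fam : IntersectingFamily (Adm rooted ⊤) r 𝒜
  fam = record
    { unique       = 𝒜!
    ; sound        = λ A∈ →
        let _ , ind , size =
              ∈-filter⁻ (λ A → independent? G A ×-dec (∣ A ∣ ≟ r)) {xs = subsets m} (𝒜⊆ A∈)
        in ((λ _ → ∈⊤) , ind) , size
    ; intersecting = int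
    }
  leaves! : Unique (leaves G)
  leaves! = Unique.filter⁺ _ (Unique.allFin⁺ m)
  -- A root of degree 1 is counted in `leaves` but cannot be a tip, so this degree is excluded here.
  trunk : degree G root ≢ 1 → Trunk rooted ⊤ (fromList (leaves G))
  trunk deg≢1 = record
    { root∈S  = ∈⊤
    ; v∈S     = ∈⊤
    ; closed  = λ _ _ _ → ∈⊤
    ; tip∈S   = λ _ → ∈⊤
    ; tip≢c   = tip≢root
    ; tip-top = λ u∈ _ u∼w → let p , u∼p , eq = parent (tip≢root u∈) in
        ≤-trans (≤-reflexive (cong height (sole-neighbour G (deg≡1 u∈) u∼w u∼p)))
          (≤-trans (n≤1+n _) (≤-reflexive (sym eq)))
    }
    where
    open RootedClaw rooted
    deg≡1 : ∀ {u} → u ∈ fromList (leaves G) → degree G u ≡ 1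
    deg≡1 u∈ = proj₂ (∈-filter⁻ (λ u → degree G u ≟ 1) {xs = allFin m} (∈-fromList⁻ u∈))
    tip≢root : ∀ {u} → u ∈ fromList (leaves G) → u ≢ root
    tip≢root u∈ refl = deg≢1 (deg≡1 u∈)
  bound : ∀ r → 1 ≤ r → length (leaves G) ≥ 2 * r →
    IntersectingFamily (Adm rooted ⊤) r 𝒜 → StarBound v (Adm rooted ⊤) r 𝒜
  -- For `r = 1` the graph may be a single edge, whose root is itself a leaf; this case avoids the
  -- trunk.
  bound 1             _ _  fam = singletons-bound (⁅v⁆-adm rooted ∈⊤) fam
  bound (suc (suc r)) _ n≥ fam with degree G root ≟ 1
  -- Set size at least two demands four leaves, but such a root allows only two.
  ... | yes deg≡1 = contradiction (≤-trans (≤-trans (*-monoʳ-≤ 2 (s≤s (s≤s z≤n))) n≥)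
                                     (leaves≤2 claw deg-v v∼root deg≡1)) λ { (s≤s (s≤s ())) }
  ... | no  deg≢1 = claw-bound rooted _ ≤-refl (trunk deg≢1)
                      (≤-trans n≥ (≤-reflexive (sym (∣fromList∣ leaves!)))) fam
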